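{- (1) If $\mathcal A$ is a family of subsets of $[n]$ which is a $k$-wise eventown for every $k\in\mathbb N$, then there exist pairwise disjoint even-sized subsets $B_1,\ldots,B_s$ of $[n]$ such that $\mathcal A\subseteq\{\bigcup_{i\in S}B_i : S\subseteq[s]\}$. (2) For $k\ge 2$, if $\mathcal A$ is a strong $k$-wise eventown in $[n]$ but not a $(k+1)$-wise eventown, then $|\mathcal A|\le 2^{\lfloor n/2\rfloor-(2^{k}-k-2)}$.
   Context: A family $\mathcal A=\{A_1,\ldots,A_m\}$ of distinct subsets of $[n]=\{1,\ldots,n\}$ is a $k$-wise eventown if $\left|\bigcap_{i\in S}A_i\right|$ is even for every $S\subseteq[m]$ with $|S|=k$. It is a strong $k$-wise eventown if it is a $k'$-wise eventown for every $k'\in\{1,\ldots,k\}$. -}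

module Defs where

open import Data.Nat using (ℕ; zero; suc; _≤_; _*_; _^_; _∸_; _+_; _/_)
open import Data.Nat.Divisibility using (_∣_)
open import Data.Fin using (Fin; zero; suc)
open import Data.Fin.Subset using (Subset; inside; outside; ⊤; ⊥; _∩_; _∪_; ∣_∣)
open import Data.Vec using ([]; _∷_)
open import Data.Product using (Σ; _×_)
open import Relation.Binary.PropositionalEquality using (_≡_; _≢_)
open import Function.Definitions using (Injective)

⋂[_]_ : ∀ {m n} → (Fin m → Subset n) → Subset m → Subset n
⋂[_]_ {zero}  A []            = ⊤
⋂[_]_ {suc m} A (inside ∷ S)  = A zero ∩ (⋂[ (λ i → A (suc i)) ] S)
⋂[_]_ {suc m} A (outside ∷ S) = ⋂[ (λ i → A (suc i)) ] S

⋃[_]_ : ∀ {m n} → (Fin m → Subset n) → Subset m → Subset n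
⋃[_]_ {zero}  B []            = ⊥
⋃[_]_ {suc m} B (inside ∷ S)  = B zero ∪ (⋃[ (λ i → B (suc i)) ] S)
⋃[_]_ {suc m} B (outside ∷ S) = ⋃[ (λ i → B (suc i)) ] S

Distinct : ∀ {m n} → (Fin m → Subset n) → Set
Distinct A = Injective _≡_ _≡_ A

EventownK : ∀ {m n} → ℕ → (Fin m → Subset n) → Set
EventownK {m} k A = (S : Subset m) → ∣ S ∣ ≡ k → 2 ∣ ∣ ⋂[ A ] S ∣

StrongEventownK : ∀ {m n} → ℕ → (Fin m → Subset n) → Set
StrongEventownK k A = (k' : ℕ) → 1 ≤ k' → k' ≤ k → EventownK k' A

DisjointEvenCover : ∀ {m n} → (Fin m → Subset n) → Set
DisjointEvenCover {m} {n} A =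
  Σ ℕ λ s → Σ (Fin s → Subset n) λ B →
    ((i j : Fin s) → i ≢ j → B i ∩ B j ≡ ⊥) ×
    ((i : Fin s) → 2 ∣ ∣ B i ∣) ×
    ((i : Fin m) → Σ (Subset s) λ S → A i ≡ ⋃[ B ] S)

{-# OPTIONS --safe #-}
-- Part (1): the atoms of the Boolean algebra generated by A that lie inside ⋃ A have even size,
-- as one sees by splitting along one member at a time, |C ∖ a| being |C| - |C ∩ a|.
--
-- Part (2): view subsets of [n] as vectors of F₂ⁿ and let x and K₀ = {1,…,k} index k + 1
-- members with odd intersection.  For S ⊆ K₀ with 2 ≤ |S| < k put v_S = ⋂_{i ∈ S} A_i and
-- w_S = A_x ∩ ⋂_{i ∈ K₀ ∖ S} A_i.  The v_S are isotropic and orthogonal to A, w_S is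
-- orthogonal to A, and w_S ∙ v_T = 1 iff S ⊆ T.  Hence adding the 2ᵏ - k - 2 vectors v_S one by
-- one, along a linear extension of inclusion, doubles the isotropic family A each time, while
-- an isotropic family has at most 2^⌊n/2⌋ members.
module Submission where

open import Defs
open import Algebra.Bundles using (CommutativeMonoid; CommutativeRing)
import Algebra.Properties.CommutativeSemigroup as CommutativeSemigroupₚ
import Data.Nat as ℕ
open import Data.Nat using (ℕ; zero; suc; z≤n; s≤s; _≤_; _<_; _*_; _^_; _∸_; _+_; _/_; _%_; _<ᵇ_)
open import Data.Nat.Properties hiding (_≟_)
open import Data.Nat.Divisibility using (_∣_; divides; n∣m⇒m%n≡0; ∣m+n∣m⇒∣n; ∣m∣n⇒∣m+n; ∣⇒≤; ∣-refl)
open import Data.Nat.DivMod using (m≡m%n+[m/n]*n; m%n<n)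
open import Data.Nat.Tactic.RingSolver using (solve-∀)
open import Data.Fin using (Fin; zero; suc)
import Data.Fin.Properties as Finₚ
open import Data.Fin.Subset using (Subset; inside; outside; ⊤; ⊥; _∩_; _∪_; ∁; ∣_∣; ⁅_⁆; _∈_; _⊆_)
open import Data.Fin.Subset.Properties
import Data.Bool as Bool
open import Data.Bool using (Bool; true; false; not; _∧_; _∨_; _xor_; if_then_else_)
open import Data.Bool.Properties using (∧-distribˡ-xor; xor-∧-commutativeRing; xor-same; ¬-not; not-involutive; T-≡)
open import Data.Vec using (Vec; []; _∷_; _++_; zipWith; lookup; here)
open import Data.Vec.Properties using (≡-dec)
open import Data.Vec.Relation.Unary.All as All using (All; []; _∷_)
import Data.Vec.Relation.Unary.All.Properties as Allₚ
open import Data.Vec.Relation.Unary.AllPairs using (AllPairs; []; _∷_)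
import Data.Vec.Relation.Unary.AllPairs.Properties as AllPairsₚ
open import Data.List as List using (List; length)
import Data.List.Properties as Listₚ
import Data.List.Relation.Unary.All as Listᴬ
import Data.List.Relation.Unary.All.Properties as Listᴬₚ
import Data.List.Relation.Unary.AllPairs as Listᴾ
import Data.List.Relation.Unary.AllPairs.Properties as Listᴾₚ
open import Data.Product using (Σ; ∃; _×_; _,_; proj₁; proj₂)
open import Data.Sum using (_⊎_; inj₁; inj₂)
open import Function using (_∘_; Equivalence)
open import Relation.Nullary using (¬_; yes; no; does; contradiction)
open import Relation.Nullary.Decidable using (_×-dec_; dec-true)
open import Relation.Binary.PropositionalEquality

private
  variable
    m n k : ℕ

  module +ₚ = CommutativeSemigroupₚ +-commutativeSemigroup
  module xorₚ = CommutativeSemigroupₚ (CommutativeRing.+-commutativeSemigroup xor-∧-commutativeRing)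
  module ∩ₚ {n : ℕ} = CommutativeSemigroupₚ (CommutativeMonoid.commutativeSemigroup (∩-commutativeMonoid n))

-- Linear algebra over F₂ on subsets.

infixl 6 _⊕_
infix 7 _∙_

parity : Subset n → Bool
parity []      = false
parity (x ∷ p) = x xor parity p

_⊕_ : Subset n → Subset n → Subset n
_⊕_ = zipWith _xor_

_∙_ : Subset n → Subset n → Bool
p ∙ q = parity (p ∩ q)

parity≡false⇒2∣∣p∣ : (p : Subset n) → parity p ≡ false → 2 ∣ ∣ p ∣
parity≡true⇒2∣1+∣p∣ : (p : Subset n) → parity p ≡ true → 2 ∣ (suc ∣ p ∣)

parity≡false⇒2∣∣p∣ []            _  = divides 0 refl
parity≡false⇒2∣∣p∣ (outside ∷ p) eq = parity≡false⇒2∣∣p∣ p eq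
parity≡false⇒2∣∣p∣ (inside ∷ p)  eq with parity p in odd
... | true = parity≡true⇒2∣1+∣p∣ p odd

parity≡true⇒2∣1+∣p∣ (outside ∷ p) eq = parity≡true⇒2∣1+∣p∣ p eq
parity≡true⇒2∣1+∣p∣ (inside ∷ p)  eq with parity p in even
... | false = ∣m∣n⇒∣m+n ∣-refl (parity≡false⇒2∣∣p∣ p even)

2∣∣p∣⇒parity≡false : (p : Subset n) → 2 ∣ ∣ p ∣ → parity p ≡ false
2∣∣p∣⇒parity≡false p 2∣p with parity p in odd
... | false = refl
... | true  = contradiction (∣⇒≤ 2∣1) λ where (s≤s ())
  where
  2∣1 : 2 ∣ 1
  2∣1 = ∣m+n∣m⇒∣n (subst (2 ∣_) (+-comm 1 ∣ p ∣) (parity≡true⇒2∣1+∣p∣ p odd)) 2∣p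

parity-⊕ : (p q : Subset n) → parity (p ⊕ q) ≡ parity p xor parity q
parity-⊕ []      []      = refl
parity-⊕ (x ∷ p) (y ∷ q) rewrite parity-⊕ p q = xorₚ.interchange x y (parity p) (parity q)

∩-distribˡ-⊕ : (p q r : Subset n) → p ∩ (q ⊕ r) ≡ (p ∩ q) ⊕ (p ∩ r)
∩-distribˡ-⊕ []      []      []      = refl
∩-distribˡ-⊕ (x ∷ p) (y ∷ q) (z ∷ r) = cong₂ _∷_ (∧-distribˡ-xor x y z) (∩-distribˡ-⊕ p q r)

∙-distribˡ-⊕ : (p q r : Subset n) → p ∙ (q ⊕ r) ≡ p ∙ q xor p ∙ r
∙-distribˡ-⊕ p q r = trans (cong parity (∩-distribˡ-⊕ p q r)) (parity-⊕ (p ∩ q) (p ∩ r))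

∙-comm : (p q : Subset n) → p ∙ q ≡ q ∙ p
∙-comm p q = cong parity (∩-comm p q)

∙-distribʳ-⊕ : (p q r : Subset n) → (q ⊕ r) ∙ p ≡ q ∙ p xor r ∙ p
∙-distribʳ-⊕ p q r = begin
  (q ⊕ r) ∙ p        ≡⟨ ∙-comm (q ⊕ r) p ⟩
  p ∙ (q ⊕ r)        ≡⟨ ∙-distribˡ-⊕ p q r ⟩
  p ∙ q xor p ∙ r    ≡⟨ cong₂ _xor_ (∙-comm p q) (∙-comm p r) ⟩
  q ∙ p xor r ∙ p    ∎
  where open ≡-Reasoning

∙-⊤ : (p : Subset n) → p ∙ ⊤ ≡ parity p
∙-⊤ p = cong parity (∩-identityʳ p)

⊕-cancelˡ : (p q : Subset n) → p ⊕ (p ⊕ q) ≡ q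
⊕-cancelˡ []          []      = refl
⊕-cancelˡ (false ∷ p) (y ∷ q) = cong (y ∷_) (⊕-cancelˡ p q)
⊕-cancelˡ (true ∷ p)  (y ∷ q) = cong₂ _∷_ (not-involutive y) (⊕-cancelˡ p q)

∁≡⊤⊕ : (p : Subset n) → ∁ p ≡ ⊤ ⊕ p
∁≡⊤⊕ []      = refl
∁≡⊤⊕ (x ∷ p) = cong (not x ∷_) (∁≡⊤⊕ p)

∙-∁ : (p q : Subset n) → p ∙ ∁ q ≡ parity p xor p ∙ q
∙-∁ p q = begin
  p ∙ ∁ q           ≡⟨ cong (p ∙_) (∁≡⊤⊕ q) ⟩
  p ∙ (⊤ ⊕ q)       ≡⟨ ∙-distribˡ-⊕ p ⊤ q ⟩
  p ∙ ⊤ xor p ∙ q   ≡⟨ cong (_xor p ∙ q) (∙-⊤ p) ⟩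
  parity p xor p ∙ q ∎
  where open ≡-Reasoning

-- Unions of index sets and the intersections they define.

∣p∪q∣≤∣p∣+∣q∣ : (p q : Subset n) → ∣ p ∪ q ∣ ≤ ∣ p ∣ + ∣ q ∣
∣p∪q∣≤∣p∣+∣q∣ []            []            = z≤n
∣p∪q∣≤∣p∣+∣q∣ (outside ∷ p) (outside ∷ q) = ∣p∪q∣≤∣p∣+∣q∣ p q
∣p∪q∣≤∣p∣+∣q∣ (outside ∷ p) (inside ∷ q)  =
  subst (suc ∣ p ∪ q ∣ ≤_) (sym (+-suc ∣ p ∣ ∣ q ∣)) (s≤s (∣p∪q∣≤∣p∣+∣q∣ p q))
∣p∪q∣≤∣p∣+∣q∣ (inside ∷ p)  (outside ∷ q) = s≤s (∣p∪q∣≤∣p∣+∣q∣ p q)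
∣p∪q∣≤∣p∣+∣q∣ (inside ∷ p)  (inside ∷ q)  =
  s≤s (≤-trans (∣p∪q∣≤∣p∣+∣q∣ p q) (+-monoʳ-≤ ∣ p ∣ (n≤1+n ∣ q ∣)))

-- Idempotence of `_∩_` absorbs the indices common to `S` and `T`. The inner product of two
-- intersections thus becomes the parity of a single one.
⋂-∪ : (A : Fin m → Subset n) (S T : Subset m) → ⋂[ A ] (S ∪ T) ≡ ⋂[ A ] S ∩ ⋂[ A ] T
⋂-∪ A []            []            = sym (∩-identityˡ ⊤)
⋂-∪ A (outside ∷ S) (outside ∷ T) = ⋂-∪ (A ∘ suc) S T
⋂-∪ A (outside ∷ S) (inside ∷ T)  =
  trans (cong (A zero ∩_) (⋂-∪ (A ∘ suc) S T)) (∩ₚ.x∙yz≈y∙xz (A zero) _ _)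
⋂-∪ A (inside ∷ S)  (outside ∷ T) =
  trans (cong (A zero ∩_) (⋂-∪ (A ∘ suc) S T)) (sym (∩-assoc (A zero) _ _))
⋂-∪ A (inside ∷ S)  (inside ∷ T)  = begin
  A zero ∩ ⋂[ A ∘ suc ] (S ∪ T)   ≡⟨ cong₂ _∩_ (sym (∩-idem (A zero))) (⋂-∪ (A ∘ suc) S T) ⟩
  (A zero ∩ A zero) ∩ (X ∩ Y)     ≡⟨ ∩-assoc (A zero) (A zero) (X ∩ Y) ⟩
  A zero ∩ (A zero ∩ (X ∩ Y))     ≡⟨ cong (A zero ∩_) (∩ₚ.x∙yz≈y∙xz (A zero) X Y) ⟩
  A zero ∩ (X ∩ (A zero ∩ Y))     ≡⟨ ∩-assoc (A zero) X (A zero ∩ Y) ⟨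
  (A zero ∩ X) ∩ (A zero ∩ Y)     ∎
  where
  open ≡-Reasoning
  X = ⋂[ A ∘ suc ] S
  Y = ⋂[ A ∘ suc ] T

⋂-⊥ : (A : Fin m → Subset n) → ⋂[ A ] ⊥ ≡ ⊤
⋂-⊥ {zero}  A = refl
⋂-⊥ {suc m} A = ⋂-⊥ (A ∘ suc)

⋂-⁅⁆ : (A : Fin m → Subset n) (i : Fin m) → ⋂[ A ] ⁅ i ⁆ ≡ A i
⋂-⁅⁆ A zero    = trans (cong (A zero ∩_) (⋂-⊥ (A ∘ suc))) (∩-identityʳ (A zero))
⋂-⁅⁆ A (suc i) = ⋂-⁅⁆ (A ∘ suc) i

-- Families of subsets as Boolean predicates, and their cardinality.

Family : ℕ → Set
Family n = Subset n → Bool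

bit : Bool → ℕ
bit false = 0
bit true  = 1

count : Family n → ℕ
count {zero}  P = bit (P [])
count {suc n} P = count (P ∘ (false ∷_)) + count (P ∘ (true ∷_))

∨-split : ∀ a {b} → a ∨ b ≡ true → a ≡ true ⊎ b ≡ true
∨-split true  _  = inj₁ refl
∨-split false eq = inj₂ eq

false≢true : false ≢ true
false≢true ()

count-empty : (P : Family n) → (∀ x → P x ≡ false) → count P ≡ 0
count-empty {zero}  P none = cong bit (none [])
count-empty {suc n} P none = cong₂ _+_ (count-empty _ (none ∘ (false ∷_))) (count-empty _ (none ∘ (true ∷_)))

count-full : (P : Family n) → (∀ x → P x ≡ true) → count P ≡ 2 ^ n
count-full {zero}  P all = cong bit (all [])
count-full {suc n} P all = cong₂ _+_ (count-full _ (all ∘ (false ∷_)))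
  (trans (count-full _ (all ∘ (true ∷_))) (sym (+-identityʳ (2 ^ n))))

count-∨ : (P Q : Family n) → (∀ x → P x ≡ true → Q x ≢ true) →
          count (λ x → P x ∨ Q x) ≡ count P + count Q
count-∨ {zero} P Q disjoint with P [] in p | Q [] in q
... | false | _     = refl
... | true  | false = refl
... | true  | true  = contradiction q (disjoint [] p)
count-∨ {suc n} P Q disjoint = trans
  (cong₂ _+_ (count-∨ (P ∘ (false ∷_)) (Q ∘ (false ∷_)) (disjoint ∘ (false ∷_)))
             (count-∨ (P ∘ (true ∷_)) (Q ∘ (true ∷_)) (disjoint ∘ (true ∷_))))
  (+ₚ.interchange (count (P ∘ (false ∷_))) _ _ _)

count-∨-≤ : (P Q : Family n) → count (λ x → P x ∨ Q x) ≤ count P + count Q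
count-∨-≤ {zero} P Q with P [] | Q []
... | false | _ = ≤-refl
... | true  | _ = s≤s z≤n
count-∨-≤ {suc n} P Q = ≤-trans
  (+-mono-≤ (count-∨-≤ (P ∘ (false ∷_)) (Q ∘ (false ∷_))) (count-∨-≤ (P ∘ (true ∷_)) (Q ∘ (true ∷_))))
  (≤-reflexive (+ₚ.interchange (count (P ∘ (false ∷_))) _ _ _))

-- Each `true` in `v` exchanges the two halves of the cube in that coordinate, which only swaps two
-- summands.
count-translate : (v : Subset n) (P : Family n) → count (P ∘ (v ⊕_)) ≡ count P
count-translate []          P = refl
count-translate (false ∷ v) P =
  cong₂ _+_ (count-translate v (P ∘ (false ∷_))) (count-translate v (P ∘ (true ∷_)))
count-translate (true ∷ v)  P = trans
  (cong₂ _+_ (count-translate v (P ∘ (true ∷_))) (count-translate v (P ∘ (false ∷_))))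
  (+-comm (count (P ∘ (true ∷_))) _)

count-inhabited : (P : Family n) (x : Subset n) → P x ≡ true → 1 ≤ count P
count-inhabited P []          p = ≤-reflexive (cong bit (sym p))
count-inhabited P (false ∷ x) p = ≤-trans (count-inhabited (P ∘ (false ∷_)) x p) (m≤m+n _ _)
count-inhabited P (true ∷ x)  p = ≤-trans (count-inhabited (P ∘ (true ∷_)) x p) (m≤n+m _ _)

count≤1 : (P : Family 0) → count P ≤ 1
count≤1 P with P []
... | false = z≤n
... | true  = ≤-refl

image : (Fin m → Subset n) → Family n
image {zero}  A x = false
image {suc m} A x = does (≡-dec Bool._≟_ x (A zero)) ∨ image (A ∘ suc) x

image⁻ : (A : Fin m → Subset n) {x : Subset n} → image A x ≡ true → ∃ λ i → x ≡ A i
image⁻ {suc m} A {x} x∈A with ≡-dec Bool._≟_ x (A zero)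
... | yes eq = zero , eq
... | no  _  with i , eq ← image⁻ (A ∘ suc) x∈A = suc i , eq

m≤count-image : (A : Fin m → Subset n) → Distinct A → m ≤ count (image A)
m≤count-image {zero}  A inj = z≤n
m≤count-image {suc m} A inj = subst (suc m ≤_) (sym (count-∨ _ _ disjoint))
  (+-mono-≤ (count-inhabited _ (A zero) (dec-true (≡-dec Bool._≟_ (A zero) (A zero)) refl))
            (m≤count-image (A ∘ suc) (λ eq → Finₚ.suc-injective (inj eq))))
  where
  disjoint : ∀ x → does (≡-dec Bool._≟_ x (A zero)) ≡ true → image (A ∘ suc) x ≢ true
  disjoint x x≡A₀ x∈A with ≡-dec Bool._≟_ x (A zero)
  ... | yes refl with i , eq ← image⁻ (A ∘ suc) x∈A with () ← inj eq

elements : Family n → List (Subset n)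
elements {zero}  P = if P [] then [] List.∷ List.[] else List.[]
elements {suc n} P =
  List.map (false ∷_) (elements (P ∘ (false ∷_))) List.++ List.map (true ∷_) (elements (P ∘ (true ∷_)))

length-elements : (P : Family n) → length (elements P) ≡ count P
length-elements {zero}  P with P []
... | false = refl
... | true  = refl
length-elements {suc n} P = trans (Listₚ.length-++ (List.map (false ∷_) (elements (P ∘ (false ∷_)))))
  (cong₂ _+_ (trans (Listₚ.length-map _ (elements (P ∘ (false ∷_)))) (length-elements (P ∘ (false ∷_))))
             (trans (Listₚ.length-map _ (elements (P ∘ (true ∷_)))) (length-elements (P ∘ (true ∷_)))))

elements-all : (P : Family n) → Listᴬ.All (λ x → P x ≡ true) (elements P)
elements-all {zero} P with P [] in p
... | false = Listᴬ.[]
... | true  = p Listᴬ.∷ Listᴬ.[]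
elements-all {suc n} P = Listᴬₚ.++⁺ (Listᴬₚ.map⁺ (elements-all (P ∘ (false ∷_))))
                                   (Listᴬₚ.map⁺ (elements-all (P ∘ (true ∷_))))

-- The list is in lexicographic order, which is a linear extension of inclusion.
elements-linear : (P : Family n) → Listᴾ.AllPairs (λ S T → ¬ T ⊆ S) (elements P)
elements-linear {zero} P with P []
... | false = Listᴾ.[]
... | true  = Listᴬ.[] Listᴾ.∷ Listᴾ.[]
elements-linear {suc n} P = Listᴾₚ.++⁺
  (Listᴾₚ.map⁺ (Listᴾ.map (_∘ drop-∷-⊆) (elements-linear (P ∘ (false ∷_)))))
  (Listᴾₚ.map⁺ (Listᴾ.map (_∘ drop-∷-⊆) (elements-linear (P ∘ (true ∷_)))))
  (Listᴬₚ.map⁺ (Listᴬ.universal (λ S → Listᴬₚ.map⁺ (Listᴬ.universal (λ T → in⊈out {p = T} {S}) _)) _))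
  where
  in⊈out : {p q : Subset n} → ¬ (inside ∷ p ⊆ outside ∷ q)
  in⊈out sub with () ← sub here

-- A product bound for pairs of families.

-- Phrased with differences so that fixing the first coordinate preserves it: two vectors with the
-- same first bit, 0 or 1, differ by 0 there. Plain orthogonality is not inherited by the slices at
-- `true`.
OrthogonalDifferences : Family n → Family n → Set
OrthogonalDifferences P Q = ∀ p p′ q q′ → P p ≡ true → P p′ ≡ true → Q q ≡ true → Q q′ ≡ true →
                            (p ⊕ p′) ∙ (q ⊕ q′) ≡ false

larger-half : (P : Family (suc n)) → ∃ λ b → count P ≤ 2 * count (P ∘ (b ∷_))
larger-half P with ≤-total (count (P ∘ (false ∷_))) (count (P ∘ (true ∷_)))
... | inj₁ le = true  , +-mono-≤ le (≤-reflexive (sym (+-identityʳ _)))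
... | inj₂ le = false , +-monoʳ-≤ _ (≤-trans le (≤-reflexive (sym (+-identityʳ _))))

-- Both sides shrink to one dimension less: either Q projects injectively and we keep the
-- larger half of P, or Q contains two vectors differing only in the first coordinate,
-- which forces that coordinate to be constant on P, and we keep the larger half of Q.
count-*-≤ : (P Q : Family n) → OrthogonalDifferences P Q → count P * count Q ≤ 2 ^ n
count-*-≤ {zero}  P Q orth = *-mono-≤ (count≤1 P) (count≤1 Q)
count-*-≤ {suc n} P Q orth
  with anySubset? (λ q → (Q (false ∷ q) Bool.≟ true) ×-dec (Q (true ∷ q) Bool.≟ true))
... | no  none = begin
  count P * count Q                    ≤⟨ *-monoˡ-≤ (count Q) P≤ ⟩
  2 * count (P ∘ (b ∷_)) * count Q     ≡⟨ *-assoc 2 (count (P ∘ (b ∷_))) (count Q) ⟩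
  2 * (count (P ∘ (b ∷_)) * count Q)   ≡⟨ cong (λ c → 2 * (count (P ∘ (b ∷_)) * c)) projection ⟨
  2 * (count (P ∘ (b ∷_)) * count Q′)  ≤⟨ *-monoʳ-≤ 2 (count-*-≤ (P ∘ (b ∷_)) Q′ orth′) ⟩
  2 * 2 ^ n                            ∎
  where
  open ≤-Reasoning
  b = proj₁ (larger-half P)
  P≤ = proj₂ (larger-half P)
  Q′ : Family n
  Q′ q = Q (false ∷ q) ∨ Q (true ∷ q)
  projection : count Q′ ≡ count Q
  projection = count-∨ _ _ λ q q₀ q₁ → none (q , q₀ , q₁)
  lift : ∀ {q} → Q′ q ≡ true → ∃ λ c → Q (c ∷ q) ≡ true
  lift {q} eq with ∨-split (Q (false ∷ q)) eq
  ... | inj₁ q₀ = false , q₀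
  ... | inj₂ q₁ = true , q₁
  orth′ : OrthogonalDifferences (P ∘ (b ∷_)) Q′
  -- The two lifts may have different first bits, but both vectors from `P` start with `b`, so this
  -- coordinate contributes nothing.
  orth′ p p′ q q′ p∈ p′∈ q∈ q′∈
    with orth (b ∷ p) (b ∷ p′) _ _ p∈ p′∈ (proj₂ (lift q∈)) (proj₂ (lift q′∈))
  ... | eq rewrite xor-same b = eq
... | yes (q , q₀ , q₁) = begin
  count P * count Q                                    ≤⟨ *-mono-≤ (proj₂ constant) Q≤ ⟩
  count (P ∘ (b ∷_)) * (2 * count (Q ∘ (c ∷_)))        ≡⟨ swap (count (P ∘ (b ∷_))) (count (Q ∘ (c ∷_))) ⟩
  2 * (count (P ∘ (b ∷_)) * count (Q ∘ (c ∷_)))        ≤⟨ *-monoʳ-≤ 2 (count-*-≤ (P ∘ (b ∷_)) (Q ∘ (c ∷_)) orth′) ⟩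
  2 * 2 ^ n                                            ∎
  where
  open ≤-Reasoning
  swap : ∀ x y → x * (2 * y) ≡ 2 * (x * y)
  swap = solve-∀
  constant : ∃ λ b → count P ≤ count (P ∘ (b ∷_))
  constant with anySubset? (λ p → P (false ∷ p) Bool.≟ true)
  ... | no  none = true , ≤-reflexive (cong (_+ count (P ∘ (true ∷_)))
                     (count-empty (P ∘ (false ∷_)) λ p → ¬-not λ eq → none (p , eq)))
  ... | yes (p , p₀) = false , ≤-reflexive (trans (cong (count (P ∘ (false ∷_)) +_)
                     (count-empty (P ∘ (true ∷_)) λ p′ → ¬-not (P₁-empty p′))) (+-identityʳ _))
    where
    P₁-empty : ∀ p′ → P (true ∷ p′) ≢ true
    -- The difference of the two vectors of `Q` is the first unit vector, whose inner product with a
    -- difference of first bit 1 is 1, against orthogonality.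
    P₁-empty p′ p₁ = false≢true (trans (sym (orth (true ∷ p′) (false ∷ p) (true ∷ q) (false ∷ q) p₁ p₀ q₁ q₀))
                               (cong not zero-rest))
      where
      zero-rest : (p′ ⊕ p) ∙ (q ⊕ q) ≡ false
      zero-rest = trans (∙-distribˡ-⊕ (p′ ⊕ p) q q) (xor-same ((p′ ⊕ p) ∙ q))
  b = proj₁ constant
  c = proj₁ (larger-half Q)
  Q≤ = proj₂ (larger-half Q)
  orth′ : OrthogonalDifferences (P ∘ (b ∷_)) (Q ∘ (c ∷_))
  orth′ p p′ q q′ p∈ p′∈ q∈ q′∈
    with orth (b ∷ p) (b ∷ p′) (c ∷ q) (c ∷ q′) p∈ p′∈ q∈ q′∈
  ... | eq rewrite xor-same b = eq

-- Isotropic families and their doubling.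

infix 4 _⟂_

_⟂_ : Subset n → Family n → Set
w ⟂ F = ∀ x → F x ≡ true → w ∙ x ≡ false

Orthogonal : Family n → Family n → Set
Orthogonal P Q = ∀ p → P p ≡ true → p ⟂ Q

orthogonal⇒differences : {P Q : Family n} → Orthogonal P Q → OrthogonalDifferences P Q
orthogonal⇒differences orth p p′ q q′ p∈ p′∈ q∈ q′∈
  rewrite ∙-distribʳ-⊕ (q ⊕ q′) p p′ | ∙-distribˡ-⊕ p q q′ | ∙-distribˡ-⊕ p′ q q′
        | orth p p∈ q q∈ | orth p p∈ q′ q′∈ | orth p′ p′∈ q q∈ | orth p′ p′∈ q′ q′∈ = refl

-- Translation by `v` is its own inverse over F₂, so `F (v ⊕ x)` says that `x` lies in the translate
-- of `F`.
double : Subset n → Family n → Family n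
double v F x = F x ∨ F (v ⊕ x)

double⁻ : (v : Subset n) (F : Family n) {x : Subset n} → double v F x ≡ true →
          ∃ λ y → F y ≡ true × (x ≡ y ⊎ x ≡ v ⊕ y)
double⁻ v F {x} x∈ with ∨-split (F x) x∈
... | inj₁ x∈F  = x , x∈F , inj₁ refl
... | inj₂ vx∈F = v ⊕ x , vx∈F , inj₂ (sym (⊕-cancelˡ v x))

⟂-double : (v : Subset n) (F : Family n) (w : Subset n) → w ∙ v ≡ false → w ⟂ F → w ⟂ double v F
⟂-double v F w w∙v w⟂F x x∈ with double⁻ v F x∈
... | y , y∈ , inj₁ refl = w⟂F y y∈
... | y , y∈ , inj₂ refl = trans (∙-distribˡ-⊕ w v y) (cong₂ _xor_ w∙v (w⟂F y y∈))

-- Pairing with `w` gives 0 on `F` and 1 on its translate by `v`, so the two are disjoint.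
count-double : (v : Subset n) (F : Family n) (w : Subset n) → w ∙ v ≡ true → w ⟂ F →
               count (double v F) ≡ 2 * count F
count-double v F w w∙v w⟂F = begin
  count (double v F)             ≡⟨ count-∨ F (F ∘ (v ⊕_)) disjoint ⟩
  count F + count (F ∘ (v ⊕_))   ≡⟨ cong (count F +_) (count-translate v F) ⟩
  count F + count F              ≡⟨ cong (count F +_) (+-identityʳ (count F)) ⟨
  2 * count F                    ∎
  where
  open ≡-Reasoning
  disjoint : ∀ x → F x ≡ true → F (v ⊕ x) ≢ true
  disjoint x x∈ vx∈ = false≢true (trans (sym (w⟂F (v ⊕ x) vx∈))
    (trans (∙-distribˡ-⊕ w v x) (cong₂ _xor_ w∙v (w⟂F x x∈))))

square-cancel-≤ : ∀ a b → a * a ≤ b * b → a ≤ b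
square-cancel-≤ a b le = ≮⇒≥ λ b<a → <⇒≱ (*-mono-< b<a b<a) le

4^h : ∀ h → 2 ^ (h * 2) ≡ 2 ^ h * 2 ^ h
4^h h = trans (cong (2 ^_) (trans (*-comm h 2) (cong (h +_) (+-identityʳ h)))) (^-distribˡ-+-* 2 h h)

-- In odd dimension the all-ones vector is orthogonal to F but not to itself, so F together
-- with its translate by ⊤ is a family of twice the size, still orthogonal to F.
isotropic-bound : (F : Family n) → Orthogonal F F → count F ≤ 2 ^ (n / 2)
isotropic-bound {n} F iso = square-cancel-≤ _ _ (square-bound (n % 2) refl)
  where
  open ≤-Reasoning
  h = n / 2
  -- Both `⊤ ∙ x` and `x ∙ x` are the parity of `x`.
  ⊤⟂F : ⊤ ⟂ F
  ⊤⟂F x x∈ = trans (cong parity (trans (∩-identityˡ x) (sym (∩-idem x)))) (iso x x∈ x x∈)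
  square-bound : ∀ r → n % 2 ≡ r → count F * count F ≤ 2 ^ h * 2 ^ h
  square-bound 0 eq = begin
    count F * count F  ≤⟨ count-*-≤ F F (orthogonal⇒differences iso) ⟩
    2 ^ n              ≡⟨ cong (2 ^_) (trans (m≡m%n+[m/n]*n n 2) (cong (_+ h * 2) eq)) ⟩
    2 ^ (h * 2)        ≡⟨ 4^h h ⟩
    2 ^ h * 2 ^ h      ∎
  square-bound 1 eq = *-cancelˡ-≤ 2 (begin
    2 * (count F * count F)       ≡⟨ swap (count F) ⟩
    count F * (2 * count F)       ≡⟨ cong (count F *_) (count-double ⊤ F ⊤ odd ⊤⟂F) ⟨
    count F * count (double ⊤ F)  ≤⟨ count-*-≤ F (double ⊤ F) (orthogonal⇒differences orth) ⟩
    2 ^ n                         ≡⟨ cong (2 ^_) (trans (m≡m%n+[m/n]*n n 2) (cong (_+ h * 2) eq)) ⟩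
    2 ^ suc (h * 2)               ≡⟨ cong (2 *_) (4^h h) ⟩
    2 * (2 ^ h * 2 ^ h)           ∎)
    where
    swap : ∀ x → 2 * (x * x) ≡ x * (2 * x)
    swap = solve-∀
    odd : ⊤ ∙ ⊤ {n} ≡ true
    odd with parity (⊤ {n}) in even | ∙-⊤ (⊤ {n})
    ... | true  | p = p
    ... | false | _ = contradiction (trans (sym eq) (n∣m⇒m%n≡0 n 2
      (subst (2 ∣_) (∣⊤∣≡n n) (parity≡false⇒2∣∣p∣ (⊤ {n}) even)))) λ ()
    orth : Orthogonal F (double ⊤ F)
    orth p p∈ = ⟂-double ⊤ F p (trans (∙-comm p ⊤) (⊤⟂F p p∈)) (iso p p∈)
  square-bound (suc (suc r)) eq = contradiction (subst (_< 2) eq (m%n<n n 2)) λ where (s≤s (s≤s ()))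

-- Enlarging an isotropic family by a triangular system of vectors.

module _ {I : Set} (v w : I → Subset n) (M : I → Set) (_≺_ : I → I → Set)
         (v∙v : ∀ {i j} → M i → M j → v i ∙ v j ≡ false)
         (w∙v : ∀ {i} → M i → w i ∙ v i ≡ true)
         (w∙v-≺ : ∀ {i j} → M i → M j → i ≺ j → w j ∙ v i ≡ false) where

  -- Each step adjoins `v i` for the head `i`, and `w i` certifies that the family doubles. Every
  -- `v j` has to stay orthogonal to the growing family to keep it isotropic, but `w j` only until
  -- its turn; so `w j ∙ v i` must vanish only for `i` before `j`.
  extend-isotropic : (L : List I) → Listᴬ.All M L → Listᴾ.AllPairs _≺_ L →
    (F : Family n) → Orthogonal F F →
    (∀ {i} → M i → v i ⟂ F) → Listᴬ.All (λ i → w i ⟂ F) L →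
    ∃ λ (G : Family n) → Orthogonal G G × count G ≡ count F * 2 ^ length L
  extend-isotropic List.[] _ _ F iso _ _ = F , iso , sym (*-identityʳ (count F))
  extend-isotropic (i List.∷ L) (Mi Listᴬ.∷ all) (i≺ Listᴾ.∷ linear) F iso v⟂F (wi⟂F Listᴬ.∷ w⟂F) =
    let G , isoG , eq = extend-isotropic L all linear F′ iso′ v⟂F′ w⟂F′ in
    G , isoG , (begin
      count G                        ≡⟨ eq ⟩
      count F′ * 2 ^ length L        ≡⟨ cong (_* 2 ^ length L) (count-double (v i) F (w i) (w∙v Mi) wi⟂F) ⟩
      2 * count F * 2 ^ length L     ≡⟨ swap (count F) (2 ^ length L) ⟩
      count F * (2 * 2 ^ length L)   ∎)
    where
    open ≡-Reasoning
    swap : ∀ x y → 2 * x * y ≡ x * (2 * y)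
    swap = solve-∀
    F′ = double (v i) F
    v⟂F′ : ∀ {j} → M j → v j ⟂ F′
    v⟂F′ {j} Mj = ⟂-double (v i) F (v j) (v∙v Mj Mi) (v⟂F Mj)
    F⟂F′ : Orthogonal F F′
    F⟂F′ y y∈ = ⟂-double (v i) F y (trans (∙-comm y (v i)) (v⟂F Mi y y∈)) (iso y y∈)
    iso′ : Orthogonal F′ F′
    iso′ x x∈ y y∈ = trans (∙-comm x y) (⟂-double (v i) F y
      (trans (∙-comm y (v i)) (v⟂F′ Mi y y∈)) (λ z z∈ → trans (∙-comm y z) (F⟂F′ z z∈ y y∈)) x x∈)
    w⟂F′ : Listᴬ.All (λ j → w j ⟂ F′) L
    w⟂F′ = Listᴬ.map (λ {j} (Mj , i≺j , wj⟂F) → ⟂-double (v i) F (w j) (w∙v-≺ Mi Mj i≺j) wj⟂F)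
             (Listᴬ.zip (all , Listᴬ.zip (i≺ , w⟂F)))

-- Counting the index sets of intermediate size.

intermediate : Family k
intermediate {k} S = not (∣ S ∣ <ᵇ 2) ∧ (∣ S ∣ <ᵇ k)

count-∣S∣<1 : ∀ k → count {k} (λ S → ∣ S ∣ <ᵇ 1) ≡ 1
count-∣S∣<1 zero    = refl
count-∣S∣<1 (suc k) = cong₂ _+_ (count-∣S∣<1 k) (count-empty {k} (λ _ → false) λ _ → refl)

-- The sets counted are the empty one and the `k` singletons.
count-∣S∣<2 : ∀ k → count {k} (λ S → ∣ S ∣ <ᵇ 2) ≡ suc k
count-∣S∣<2 zero    = refl
count-∣S∣<2 (suc k) = trans (cong₂ _+_ (count-∣S∣<2 k) (count-∣S∣<1 k)) (+-comm (suc k) 1)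

-- Only the full set qualifies.
count-∣S∣≮k : ∀ k → count {k} (λ S → not (∣ S ∣ <ᵇ k)) ≡ 1
count-∣S∣≮k zero    = refl
count-∣S∣≮k (suc k) = cong₂ _+_
  (count-empty {k} (λ S → not (∣ S ∣ <ᵇ suc k)) λ S → cong not (Equivalence.to T-≡ (<⇒<ᵇ (s≤s (∣p∣≤n S))))) (count-∣S∣≮k k)

-- At most `k + 2` sets are excluded: the empty one, the singletons and the full one. Subadditivity
-- of `count` suffices, and it tolerates that for `k < 2` a set can be both small and large.
count-intermediate : ∀ k → 2 ^ k ∸ k ∸ 2 ≤ count (intermediate {k})
count-intermediate k = m≤n+o⇒m∸n≤o (2 ^ k ∸ k) 2 (m≤n+o⇒m∸n≤o (2 ^ k) k total)
  where
  open ≤-Reasoning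
  small large : Family k
  small S = ∣ S ∣ <ᵇ 2
  large S = not (∣ S ∣ <ᵇ k)
  cases : ∀ a b → (not a ∧ b) ∨ (a ∨ not b) ≡ true
  cases true  b     = refl
  cases false true  = refl
  cases false false = refl
  rearrange : ∀ c k → c + (suc k + 1) ≡ k + (2 + c)
  rearrange = solve-∀
  total : 2 ^ k ≤ k + (2 + count (intermediate {k}))
  total = begin
    2 ^ k
      ≡⟨ count-full {k} (λ S → intermediate S ∨ (small S ∨ large S)) (λ S → cases (small S) (∣ S ∣ <ᵇ k)) ⟨
    count {k} (λ S → intermediate S ∨ (small S ∨ large S))
      ≤⟨ count-∨-≤ (intermediate {k}) (λ S → small S ∨ large S) ⟩
    count (intermediate {k}) + count (λ S → small S ∨ large S)
      ≤⟨ +-monoʳ-≤ (count (intermediate {k})) (count-∨-≤ small large) ⟩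
    count (intermediate {k}) + (count small + count large)
      ≡⟨ cong (count (intermediate {k}) +_) (cong₂ _+_ (count-∣S∣<2 k) (count-∣S∣≮k k)) ⟩
    count (intermediate {k}) + (suc k + 1)
      ≡⟨ rearrange (count (intermediate {k})) k ⟩
    k + (2 + count (intermediate {k}))  ∎

intermediate⁻ : {S : Subset k} → intermediate S ≡ true → 2 ≤ ∣ S ∣ × ∣ S ∣ < k
intermediate⁻ {k} {S} eq with ∣ S ∣ <ᵇ 2 in small | ∣ S ∣ <ᵇ k in proper
... | false | true = ≮⇒≥ (λ lt → false≢true (trans (sym small) (Equivalence.to T-≡ (<⇒<ᵇ lt))))
                   , <ᵇ⇒< ∣ S ∣ k (Equivalence.from T-≡ proper)

-- Relabels the elements of `K` in increasing order by `Fin ∣ K ∣`, so that subsets of `K` become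
-- all bit vectors of that length and complements are taken within `K`.
embed : (K : Subset m) → Subset ∣ K ∣ → Subset m
embed []            S       = []
embed (outside ∷ K) S       = outside ∷ embed K S
embed (inside ∷ K)  (x ∷ S) = x ∷ embed K S

embed-∪ : (K : Subset m) (S T : Subset ∣ K ∣) → embed K (S ∪ T) ≡ embed K S ∪ embed K T
embed-∪ []            S       T       = refl
embed-∪ (outside ∷ K) S       T       = cong (outside ∷_) (embed-∪ K S T)
embed-∪ (inside ∷ K)  (x ∷ S) (y ∷ T) = cong ((x ∨ y) ∷_) (embed-∪ K S T)

∣embed∣ : (K : Subset m) (S : Subset ∣ K ∣) → ∣ embed K S ∣ ≡ ∣ S ∣
∣embed∣ []            []            = refl
∣embed∣ (outside ∷ K) S             = ∣embed∣ K S
∣embed∣ (inside ∷ K)  (outside ∷ S) = ∣embed∣ K S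
∣embed∣ (inside ∷ K)  (inside ∷ S)  = cong suc (∣embed∣ K S)

embed-⊤ : (K : Subset m) → embed K ⊤ ≡ K
embed-⊤ []            = refl
embed-⊤ (outside ∷ K) = cong (outside ∷_) (embed-⊤ K)
embed-⊤ (inside ∷ K)  = cong (inside ∷_) (embed-⊤ K)

-- Vectors from a strong eventown with an odd `(k + 1)`-fold intersection.

module _ (A : Fin m → Subset n) (distinct : Distinct A) (2≤k : 2 ≤ k)
         (even : (S : Subset m) → 1 ≤ ∣ S ∣ → ∣ S ∣ ≤ k → parity (⋂[ A ] S) ≡ false)
         (e : Subset (suc k) → Subset m)
         (e-∪ : ∀ S T → e (S ∪ T) ≡ e S ∪ e T)
         (∣e∣ : ∀ S → ∣ e S ∣ ≡ ∣ S ∣)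
         (odd : parity (⋂[ A ] (e ⊤)) ≡ true) where

  private
    ∙-⋂ : ∀ S T → ⋂[ A ] S ∙ ⋂[ A ] T ≡ parity (⋂[ A ] (S ∪ T))
    ∙-⋂ S T = cong parity (sym (⋂-∪ A S T))

    ∙-⋂-e : ∀ S T → ⋂[ A ] (e S) ∙ ⋂[ A ] (e T) ≡ parity (⋂[ A ] (e (S ∪ T)))
    ∙-⋂-e S T = trans (∙-⋂ (e S) (e T)) (cong (λ X → parity (⋂[ A ] X)) (sym (e-∪ S T)))

    even-e : ∀ S → 1 ≤ ∣ S ∣ → ∣ S ∣ ≤ k → parity (⋂[ A ] (e S)) ≡ false
    even-e S 1≤S S≤k = even (e S) (subst (1 ≤_) (sym (∣e∣ S)) 1≤S) (subst (_≤ k) (sym (∣e∣ S)) S≤k)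

    -- Adjoining `i` gives at most `∣ S ∣ + 1 ≤ k` indices, so the intersection is still even.
    ⋂∙A : ∀ S → 1 ≤ ∣ S ∣ → ∣ S ∣ < k → ∀ i → ⋂[ A ] S ∙ A i ≡ false
    ⋂∙A S 1≤S S<k i = begin
      ⋂[ A ] S ∙ A i               ≡⟨ cong (⋂[ A ] S ∙_) (⋂-⁅⁆ A i) ⟨
      ⋂[ A ] S ∙ ⋂[ A ] ⁅ i ⁆      ≡⟨ ∙-⋂ S ⁅ i ⁆ ⟩
      parity (⋂[ A ] (S ∪ ⁅ i ⁆))  ≡⟨ even (S ∪ ⁅ i ⁆) (≤-trans 1≤S (∣p∣≤∣p∪q∣ S ⁅ i ⁆)) size ⟩
      false                        ∎
      where
      open ≡-Reasoning
      size : ∣ S ∪ ⁅ i ⁆ ∣ ≤ k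
      size = ≤-trans (∣p∪q∣≤∣p∣+∣q∣ S ⁅ i ⁆)
        (subst (_≤ k) (trans (+-comm 1 ∣ S ∣) (cong (∣ S ∣ +_) (sym (∣⁅x⁆∣≡1 i)))) S<k)

    ⋂e⟂A : ∀ S → 1 ≤ ∣ S ∣ → ∣ S ∣ < k → ⋂[ A ] (e S) ⟂ image A
    ⋂e⟂A S 1≤S S<k x x∈ with i , refl ← image⁻ A x∈ =
      ⋂∙A (e S) (subst (1 ≤_) (sym (∣e∣ S)) 1≤S) (subst (_< k) (sym (∣e∣ S)) S<k) i

    M : Subset k → Set
    M S = intermediate S ≡ true

    -- The first coordinate is the distinguished index x: it is left out of v and belongs to w.
    v w : Subset k → Subset n
    v S = ⋂[ A ] (e (outside ∷ S))
    w S = ⋂[ A ] (e (inside ∷ ∁ S))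

    -- The distinguished index is absent from both, so their union has at most `k` indices.
    v∙v : ∀ {S T} → M S → M T → v S ∙ v T ≡ false
    v∙v {S} {T} MS MT = trans (∙-⋂-e (outside ∷ S) (outside ∷ T))
      (even-e (outside ∷ (S ∪ T)) (≤-trans (<⇒≤ (proj₁ (intermediate⁻ {S = S} MS))) (∣p∣≤∣p∪q∣ S T)) (∣p∣≤n (S ∪ T)))

    -- The sets `S` and `∁ S` and the distinguished index exhaust all `k + 1` indices, whose
    -- intersection is odd.
    w∙v : ∀ {S} → M S → w S ∙ v S ≡ true
    w∙v {S} MS = begin
      w S ∙ v S                                ≡⟨ ∙-⋂-e (inside ∷ ∁ S) (outside ∷ S) ⟩
      parity (⋂[ A ] (e (inside ∷ (∁ S ∪ S)))) ≡⟨ cong (λ X → parity (⋂[ A ] (e (inside ∷ X)))) (trans (∪-comm (∁ S) S) (p∪∁p≡⊤ S)) ⟩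
      parity (⋂[ A ] (e ⊤))                    ≡⟨ odd ⟩
      true                                     ∎
      where open ≡-Reasoning

    -- An element of `T` outside `S` is missing from `∁ T ∪ S`, so even with the distinguished index
    -- at most `k` indices occur.
    w∙v-≺ : ∀ {S T} → M S → M T → ¬ T ⊆ S → w T ∙ v S ≡ false
    w∙v-≺ {S} {T} MS MT T⊈S = trans (∙-⋂-e (inside ∷ ∁ T) (outside ∷ S))
      (even-e (inside ∷ (∁ T ∪ S)) (s≤s z≤n) (≤∧≢⇒< (∣p∣≤n (∁ T ∪ S)) λ eq → T⊈S (cover⇒⊆ (∣p∣≡n⇒p≡⊤ eq))))
      where
      cover⇒⊆ : ∁ T ∪ S ≡ ⊤ → T ⊆ S
      cover⇒⊆ eq {x} x∈T with x∈p∪q⁻ (∁ T) S (subst (x ∈_) (sym eq) ∈⊤)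
      ... | inj₁ x∈∁T = contradiction x∈T (x∈∁p⇒x∉p x∈∁T)
      ... | inj₂ x∈S  = x∈S

    v⟂A : ∀ {S} → M S → v S ⟂ image A
    v⟂A {S} MS with 2≤S , S<k ← intermediate⁻ {S = S} MS = ⋂e⟂A (outside ∷ S) (<⇒≤ 2≤S) S<k

    w⟂A : ∀ {S} → M S → w S ⟂ image A
    w⟂A {S} MS with 2≤S , S<k ← intermediate⁻ {S = S} MS = ⋂e⟂A (inside ∷ ∁ S) (s≤s z≤n) size
      where
      size : suc ∣ ∁ S ∣ < k
      -- Here `2 ≤ ∣ S ∣` enters: `w S` involves `1 + (k ∸ ∣ S ∣)` indices, which must stay below
      -- `k`.
      size = subst (λ c → 2 + c ≤ k) (sym (∣∁p∣≡n∸∣p∣ S))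
        (≤-trans (+-monoˡ-≤ (k ∸ ∣ S ∣) 2≤S) (≤-reflexive (m+[n∸m]≡n (<⇒≤ S<k))))

    A∙A : Orthogonal (image A) (image A)
    A∙A x x∈ y y∈ with i , refl ← image⁻ A x∈ | j , refl ← image⁻ A y∈ =
      trans (cong (_∙ A j) (sym (⋂-⁅⁆ A i)))
        (⋂∙A ⁅ i ⁆ (≤-reflexive (sym (∣⁅x⁆∣≡1 i))) (subst (_< k) (sym (∣⁅x⁆∣≡1 i)) 2≤k) j)

  eventown-bound : m * 2 ^ (2 ^ k ∸ k ∸ 2) ≤ 2 ^ (n / 2)
  eventown-bound
    with G , isoG , eq ← extend-isotropic v w M (λ S T → ¬ T ⊆ S) v∙v w∙v w∙v-≺
           (elements intermediate) (elements-all intermediate) (elements-linear intermediate)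
           (image A) A∙A v⟂A (Listᴬ.map w⟂A (elements-all intermediate))
    = begin
      m * 2 ^ (2 ^ k ∸ k ∸ 2)
        ≤⟨ *-mono-≤ (m≤count-image A distinct) (^-monoʳ-≤ 2 (≤-trans (count-intermediate k)
             (≤-reflexive (sym (length-elements (intermediate {k})))))) ⟩
      count (image A) * 2 ^ length (elements (intermediate {k}))  ≡⟨ eq ⟨
      count G                                                     ≤⟨ isotropic-bound G isoG ⟩
      2 ^ (n / 2)                                                 ∎
    where open ≤-Reasoning

-- Partitions into even parts cut out by a family.

record EvenParts (C : Subset n) : Set where
  field
    {size}   : ℕ
    parts    : Vec (Subset n) size
    disjoint : AllPairs (λ p q → p ∩ q ≡ ⊥) parts
    even     : All (λ p → parity p ≡ false) parts
    within   : All (_⊆ C) parts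

open EvenParts

UnionOf : Vec (Subset n) m → Subset n → Set
UnionOf {m = m} ps X = ∃ λ (S : Subset m) → X ≡ ⋃[ lookup ps ] S

⋃-⊥ : (A : Fin m → Subset n) → ⋃[ A ] ⊥ ≡ ⊥
⋃-⊥ {zero}  A = refl
⋃-⊥ {suc m} A = ⋃-⊥ (A ∘ suc)

⋃-++ : (ps : Vec (Subset n) m) (qs : Vec (Subset n) k) (S : Subset m) (T : Subset k) →
       ⋃[ lookup (ps ++ qs) ] (S ++ T) ≡ ⋃[ lookup ps ] S ∪ ⋃[ lookup qs ] T
⋃-++ []       qs []            T = sym (∪-identityˡ _)
⋃-++ (p ∷ ps) qs (inside ∷ S)  T = trans (cong (p ∪_) (⋃-++ ps qs S T)) (sym (∪-assoc p _ _))
⋃-++ (p ∷ ps) qs (outside ∷ S) T = ⋃-++ ps qs S T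

UnionOf-++ : (ps : Vec (Subset n) m) (qs : Vec (Subset n) k) {X Y Z : Subset n} →
             Z ≡ X ∪ Y → UnionOf ps X → UnionOf qs Y → UnionOf (ps ++ qs) Z
UnionOf-++ ps qs eq (S , refl) (T , refl) = S ++ T , trans eq (sym (⋃-++ ps qs S T))

UnionOf-⊥ : (ps : Vec (Subset n) m) → UnionOf ps ⊥
UnionOf-⊥ ps = ⊥ , sym (⋃-⊥ (lookup ps))

split-by : (C a : Subset n) → C ≡ (C ∩ a) ∪ (C ∩ ∁ a)
split-by C a = sym (trans (sym (∩-distribˡ-∪ C a (∁ a))) (trans (cong (C ∩_) (p∪∁p≡⊤ a)) (∩-identityʳ C)))

split-∩ : (C a X : Subset n) → C ∩ X ≡ ((C ∩ a) ∩ X) ∪ ((C ∩ ∁ a) ∩ X)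
split-∩ C a X = trans (cong (_∩ X) (split-by C a)) (∩-distribʳ-∪ X (C ∩ a) (C ∩ ∁ a))

-- Parts from different halves are disjoint because one lies inside `a` and the other inside its
-- complement; `within` is recorded for this.
join : (C a : Subset n) → EvenParts (C ∩ a) → EvenParts (C ∩ ∁ a) → EvenParts C
join C a P Q = record
  { parts    = parts P ++ parts Q
  ; disjoint = AllPairsₚ.++⁺ (disjoint P) (disjoint Q)
      (All.map {P = _⊆ C ∩ a} (λ p⊆ → All.map {P = _⊆ C ∩ ∁ a} (λ q⊆ → disjoint-halves p⊆ q⊆) (within Q)) (within P))
  ; even     = Allₚ.++⁺ (even P) (even Q)
  ; within   = Allₚ.++⁺ (All.map {P = _⊆ C ∩ a} {Q = _⊆ C} (λ p⊆ → p∩q⊆p C a ∘ p⊆) (within P))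
                        (All.map {P = _⊆ C ∩ ∁ a} {Q = _⊆ C} (λ q⊆ → p∩q⊆p C (∁ a) ∘ q⊆) (within Q))
  }
  where
  disjoint-halves : ∀ {p q} → p ⊆ C ∩ a → q ⊆ C ∩ ∁ a → p ∩ q ≡ ⊥
  disjoint-halves {p} {q} p⊆ q⊆ = Empty-unique λ (x , x∈) →
    x∈∁p⇒x∉p (proj₂ (x∈p∩q⁻ C (∁ a) (q⊆ (proj₂ (x∈p∩q⁻ p q x∈)))))
             (proj₂ (x∈p∩q⁻ C a (p⊆ (proj₁ (x∈p∩q⁻ p q x∈)))))

parity-∁-part : (C a X : Subset n) → parity (C ∩ X) ≡ false → parity (C ∩ (a ∩ X)) ≡ false →
                parity ((C ∩ ∁ a) ∩ X) ≡ false
parity-∁-part C a X even₁ even₂ = begin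
  parity ((C ∩ ∁ a) ∩ X)               ≡⟨ cong parity (swap (∁ a)) ⟩
  (C ∩ X) ∙ ∁ a                        ≡⟨ ∙-∁ (C ∩ X) a ⟩
  parity (C ∩ X) xor (C ∩ X) ∙ a       ≡⟨ cong₂ _xor_ even₁ (trans (cong parity (trans (sym (swap a)) (∩-assoc C a X))) even₂) ⟩
  false                                ∎
  where
  open ≡-Reasoning
  swap : ∀ b → (C ∩ b) ∩ X ≡ (C ∩ X) ∩ b
  swap b = ∩ₚ.xy∙z≈xz∙y C b X

-- Both halves of `C` along `A zero` inherit the hypothesis for the remaining members. The empty `S`
-- makes `C` itself even, so once no members remain `C` serves as the single part, possibly empty.
even-partition : (A : Fin m → Subset n) (C : Subset n) → (∀ S → parity (C ∩ ⋂[ A ] S) ≡ false) →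
  Σ (EvenParts C) λ P → UnionOf (parts P) C × (∀ i → UnionOf (parts P) (C ∩ A i))
even-partition {zero} A C ev =
  record { parts    = C ∷ []
         ; disjoint = [] ∷ []
         ; even     = trans (cong parity (sym (∩-identityʳ C))) (ev []) ∷ []
         ; within   = ⊆-refl ∷ []
         }
  , (inside ∷ [] , sym (∪-identityʳ C)) , λ ()
even-partition {suc m} A C ev
  with P , P-C , P-A ← even-partition (A ∘ suc) (C ∩ A zero)
         (λ S → trans (cong parity (∩-assoc C (A zero) _)) (ev (inside ∷ S)))
     | Q , Q-C , Q-A ← even-partition (A ∘ suc) (C ∩ ∁ (A zero))
         (λ S → parity-∁-part C (A zero) _ (ev (outside ∷ S)) (ev (inside ∷ S)))
  = join C (A zero) P Q , UnionOf-++ (parts P) (parts Q) (split-by C (A zero)) P-C Q-C , λ where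
      -- `C ∩ A zero` is the union of all parts of the first half and none of the second.
      zero    → UnionOf-++ (parts P) (parts Q) (sym (∪-identityʳ _)) P-C (UnionOf-⊥ (parts Q))
      (suc i) → UnionOf-++ (parts P) (parts Q) (split-∩ C (A zero) (A (suc i))) (P-A i) (Q-A i)

-- Here `C` may be odd, as only nonempty `S` are controlled. The half inside `A zero` satisfies the
-- stronger hypothesis, since `inside ∷ S` is never empty, and is partitioned. The other half is
-- treated recursively, and what lies in no member is dropped at the base.
even-cover : (A : Fin m → Subset n) (C : Subset n) → (∀ S → 1 ≤ ∣ S ∣ → parity (C ∩ ⋂[ A ] S) ≡ false) →
  Σ (EvenParts C) λ P → ∀ i → UnionOf (parts P) (C ∩ A i)
even-cover {zero} A C ev = record { parts = [] ; disjoint = [] ; even = [] ; within = [] } , λ ()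
even-cover {suc m} A C ev
  with P , P-C , P-A ← even-partition (A ∘ suc) (C ∩ A zero)
         (λ S → trans (cong parity (∩-assoc C (A zero) _)) (ev (inside ∷ S) (s≤s z≤n)))
     | Q , Q-A ← even-cover (A ∘ suc) (C ∩ ∁ (A zero))
         (λ S 1≤S → parity-∁-part C (A zero) _ (ev (outside ∷ S) 1≤S) (ev (inside ∷ S) (s≤s z≤n)))
  = join C (A zero) P Q , λ where
      zero    → UnionOf-++ (parts P) (parts Q) (sym (∪-identityʳ _)) P-C (UnionOf-⊥ (parts Q))
      (suc i) → UnionOf-++ (parts P) (parts Q) (split-∩ C (A zero) (A (suc i))) (P-A i) (Q-A i)

lookup-disjoint : {ps : Vec (Subset n) m} → AllPairs (λ p q → p ∩ q ≡ ⊥) ps →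
                  (i j : Fin m) → i ≢ j → lookup ps i ∩ lookup ps j ≡ ⊥
lookup-disjoint (p ∷ ps) zero    zero    i≢j = contradiction refl i≢j
lookup-disjoint (p ∷ ps) zero    (suc j) i≢j = Allₚ.lookup⁺ p j
lookup-disjoint (p ∷ ps) (suc i) zero    i≢j = trans (∩-comm _ _) (Allₚ.lookup⁺ p i)
lookup-disjoint (p ∷ ps) (suc i) (suc j) i≢j = lookup-disjoint ps i j (i≢j ∘ cong suc)

theorem1p4 : ((m n : ℕ) (A : Fin m → Subset n) → Distinct A →
    ((k : ℕ) → 1 ≤ k → EventownK k A) → DisjointEvenCover A)
    ×
    ((m n k : ℕ) (A : Fin m → Subset n) → Distinct A → 2 ≤ k →
    StrongEventownK k A → ¬ EventownK (k + 1) A →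
    m * 2 ^ (2 ^ k ∸ k ∸ 2) ≤ 2 ^ (n / 2))
theorem1p4 = part₁ , part₂
  where
  part₁ : (m n : ℕ) (A : Fin m → Subset n) → Distinct A →
    ((k : ℕ) → 1 ≤ k → EventownK k A) → DisjointEvenCover A
  -- The ambient set is `⊤`, which may be odd; hence `even-cover` and not `even-partition`.
  part₁ m n A _ town
    with P , union ← even-cover A ⊤ (λ S 1≤S →
           trans (cong parity (∩-identityˡ (⋂[ A ] S))) (2∣∣p∣⇒parity≡false (⋂[ A ] S) (town ∣ S ∣ 1≤S S refl)))
    = size P , lookup (parts P) , lookup-disjoint (disjoint P)
    , (λ i → parity≡false⇒2∣∣p∣ (lookup (parts P) i) (Allₚ.lookup⁺ (even P) i))
    , λ i → proj₁ (union i) , trans (sym (∩-identityˡ (A i))) (proj₂ (union i))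

  part₂ : (m n k : ℕ) (A : Fin m → Subset n) → Distinct A → 2 ≤ k →
    StrongEventownK k A → ¬ EventownK (k + 1) A →
    m * 2 ^ (2 ^ k ∸ k ∸ 2) ≤ 2 ^ (n / 2)
  part₂ m n k A distinct 2≤k town ¬town
    -- The hypothesis is only a negation, so the odd intersection is found by exhaustive search over
    -- index sets.
    with anySubset? (λ K → (∣ K ∣ ℕ.≟ suc k) ×-dec (parity (⋂[ A ] K) Bool.≟ true))
  ... | no none = contradiction (λ K ∣K∣ → parity≡false⇒2∣∣p∣ (⋂[ A ] K)
          (¬-not λ odd → none (K , trans ∣K∣ (+-comm k 1) , odd))) ¬town
  ... | yes (K , ∣K∣ , odd) = bound (embed K) (embed-∪ K) (∣embed∣ K) (embed-⊤ K) ∣K∣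
    where
    -- The length `j` is kept variable so that `j ≡ suc k` can be matched with `refl`; `∣ K ∣`
    -- itself is not a variable.
    bound : ∀ {j} (e : Subset j → Subset m) → (∀ S T → e (S ∪ T) ≡ e S ∪ e T) →
            (∀ S → ∣ e S ∣ ≡ ∣ S ∣) → e ⊤ ≡ K → j ≡ suc k → m * 2 ^ (2 ^ k ∸ k ∸ 2) ≤ 2 ^ (n / 2)
    bound e e-∪ ∣e∣ e-⊤ refl = eventown-bound A distinct 2≤k
      (λ S 1≤S S≤k → 2∣∣p∣⇒parity≡false (⋂[ A ] S) (town ∣ S ∣ 1≤S S≤k S refl))
      e e-∪ ∣e∣ (trans (cong (λ X → parity (⋂[ A ] X)) e-⊤) odd)
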